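{- Let $G$ be a connected graph with $n > 3$ vertices such that $\alpha(G)=2$. Then $G$ contains a swap set and, furthermore, $DD_{\mathrm{m}}(G) \leq 2$.
   Context: Graphs are finite, simple and undirected; $\alpha(G)$ is the independence number. Swap number: a dominating set $D$ of a graph $G$ is a swap set if there is a dominating set $D'$ of $G$ with $D\cap D'=\emptyset$, $|D|=|D'|$, such that $G$ contains a perfect matching between $D$ and $D'$ (a bijection $f:D\to D'$ with $x f(x)\in E(G)$ for all $x\in D$). $DD_{\mathrm{m}}(G)$ is the minimum cardinality of a swap set of $G$, and $DD_{\mathrm{m}}(G)=\infty$ if none exists. -}

module Defs where

open import Data.Fin.Base using (Fin)
open import Data.Fin.Properties using (any?; all?) renaming (_≟_ to _≟ᶠ_)
open import Data.Fin.Subset using (Subset; _∈_; _∉_; _∩_; ∣_∣; Empty; ⊥)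
open import Data.Fin.Subset.Properties using (_∈?_; nonempty?; anySubset?; ∣p∣≤n; ∉⊥)
open import Data.Nat.Base using (ℕ; zero; suc; _≤_; _<_; _∸_)
open import Data.Nat.Induction using (<-wellFounded)
open import Data.Nat.Properties using (_≟_; _<?_; ≮⇒≥; ∸-cancelʳ-≤)
open import Data.Product.Base using (Σ; ∃; _×_; _,_; proj₁; proj₂)
open import Data.Vec.Base using (Vec; []; _∷_; lookup; tabulate)
open import Data.Vec.Properties using (lookup∘tabulate)
open import Data.Vec.Properties.WithK using ([]=-irrelevant)
open import Function.Base using (_∘_)
open import Function.Bundles using (_⤖_; mk⤖; module Bijection)
open import Induction.WellFounded using (Acc; acc)
open import Level using (0ℓ)
open import Relation.Binary.Construct.Closure.ReflexiveTransitive using (Star)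
open import Relation.Binary.Core using (Rel)
import Relation.Binary.Definitions as B
open import Relation.Binary.PropositionalEquality using (_≡_; refl; sym; trans; cong; subst)
open import Relation.Nullary using (¬_; Dec; yes; no; contradiction)
open import Relation.Nullary.Construct.Add.Supremum using (_⁺; ⊤⁺; [_])
open import Relation.Nullary.Decidable using (map′; ¬?; _×-dec_; _→-dec_)
open import Relation.Unary using (Pred; Decidable)

open import Relation.Binary.Construct.Add.Supremum.NonStrict _≤_ public using (_≤⁺_)

record Graph (n : ℕ) : Set₁ where
  field
    Adj      : Rel (Fin n) 0ℓ
    adj?     : B.Decidable Adj
    adj-sym  : B.Symmetric Adj
    adj-irr  : ∀ {x} → ¬ Adj x x

module _ {n : ℕ} where

  Maximum : Pred (Subset n) 0ℓ → Pred ℕ 0ℓ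
  Maximum P k = (∃ λ S → P S × ∣ S ∣ ≡ k) × (∀ S → P S → ∣ S ∣ ≤ k)

  -- The minimum over the empty family is ∞, written ⊤⁺.
  Minimum : Pred (Subset n) 0ℓ → Pred (ℕ ⁺) 0ℓ
  Minimum P ⊤⁺    = ¬ (∃ λ S → P S)
  Minimum P [ k ] = (∃ λ S → P S × ∣ S ∣ ≡ k) × (∀ S → P S → k ≤ ∣ S ∣)

  private
    minimize : ∀ {P : Pred (Subset n) 0ℓ} → Decidable P → (f : Subset n → ℕ) →
               ∀ S → P S → Acc _<_ (f S) →
               ∃ λ M → P M × (∀ T → P T → f M ≤ f T)
    minimize P? f S pS (acc rs) with anySubset? (λ T → P? T ×-dec (f T <? f S))
    ... | yes (T , pT , fT<fS) = minimize P? f T pT (rs fT<fS)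
    ... | no  none             = S , pS , λ T pT → ≮⇒≥ λ lt → none (T , pT , lt)

  maximum : ∀ {P : Pred (Subset n) 0ℓ} → Decidable P → ∃ P → ∃ (Maximum P)
  maximum P? (S , pS) =
    let M , pM , least = minimize P? (λ T → n ∸ ∣ T ∣) S pS (<-wellFounded _)
    in ∣ M ∣ , (M , pM , refl) , λ T pT → ∸-cancelʳ-≤ (∣p∣≤n T) (least T pT)

  minimum : ∀ {P : Pred (Subset n) 0ℓ} → Decidable P → ∃ (Minimum P)
  minimum P? with anySubset? P?
  ... | no  none     = ⊤⁺ , none
  ... | yes (S , pS) =
    let M , pM , least = minimize P? ∣_∣ S pS (<-wellFounded _)
    in [ ∣ M ∣ ] , (M , pM , refl) , least

module _ {n : ℕ} (G : Graph n) where

  open Graph G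

  Connected : Set
  Connected = ∀ x y → Star Adj x y

  Independent : Pred (Subset n) 0ℓ
  Independent S = ∀ x y → x ∈ S → y ∈ S → ¬ Adj x y

  Dominating : Pred (Subset n) 0ℓ
  Dominating D = ∀ x → x ∉ D → ∃ λ y → y ∈ D × Adj x y

  PerfectMatching : Rel (Subset n) 0ℓ
  PerfectMatching D D′ =
    Σ (∃ (_∈ D) ⤖ ∃ (_∈ D′)) λ f → ∀ x → Adj (proj₁ x) (proj₁ (Bijection.to f x))

  SwapSet : Pred (Subset n) 0ℓ
  SwapSet D = Dominating D × ∃ λ D′ →
    Dominating D′ × Empty (D ∩ D′) × ∣ D ∣ ≡ ∣ D′ ∣ × PerfectMatching D D′

  independent? : Decidable Independent
  independent? S = all? λ x → all? λ y →
    (x ∈? S) →-dec ((y ∈? S) →-dec ¬? (adj? x y))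

  dominating? : Decidable Dominating
  dominating? D = all? λ x → ¬? (x ∈? D) →-dec any? λ y → (y ∈? D) ×-dec adj? x y

  private
    anyVec? : ∀ m {P : Pred (Vec (Fin n) m) 0ℓ} → Decidable P → Dec (∃ P)
    anyVec? zero    P? = map′ (λ p → [] , p) (λ { ([] , p) → p }) (P? [])
    anyVec? (suc m) P? = map′ (λ { (x , xs , p) → x ∷ xs , p })
                              (λ { (x ∷ xs , p) → x , xs , p })
                              (any? λ x → anyVec? m (P? ∘ (x ∷_)))

    -- Matchings as value tables; only the entries at members of D matter.
    Table : Subset n → Subset n → Vec (Fin n) n → Set
    Table D D′ v =
        (∀ x → x ∈ D → lookup v x ∈ D′ × Adj x (lookup v x))
      × (∀ x y → x ∈ D → y ∈ D → lookup v x ≡ lookup v y → x ≡ y)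
      × (∀ z → z ∈ D′ → ∃ λ x → x ∈ D × lookup v x ≡ z)

    table? : ∀ D D′ → Decidable (Table D D′)
    table? D D′ v =
      (all? λ x → (x ∈? D) →-dec ((lookup v x ∈? D′) ×-dec adj? x (lookup v x)))
      ×-dec
      (all? λ x → all? λ y → (x ∈? D) →-dec ((y ∈? D) →-dec
        ((lookup v x ≟ᶠ lookup v y) →-dec (x ≟ᶠ y))))
      ×-dec
      (all? λ z → (z ∈? D′) →-dec any? λ x → (x ∈? D) ×-dec (lookup v x ≟ᶠ z))

    ∈-≡ : ∀ {S : Subset n} {a b : ∃ (_∈ S)} → proj₁ a ≡ proj₁ b → a ≡ b
    ∈-≡ {a = x , p} {b = _ , q} refl = cong (x ,_) ([]=-irrelevant p q)

    fromTable : ∀ {D D′} → ∃ (Table D D′) → PerfectMatching D D′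
    fromTable {D} {D′} (v , val , inj , sur) =
      mk⤖ {to = to} (to-inj , to-sur) , λ (x , p) → proj₂ (val x p)
      where
      to : ∃ (_∈ D) → ∃ (_∈ D′)
      to (x , p) = lookup v x , proj₁ (val x p)
      to-inj : ∀ {a b} → to a ≡ to b → a ≡ b
      to-inj {x , p} {y , q} eq = ∈-≡ (inj x y p q (cong proj₁ eq))
      to-sur : ∀ b → ∃ λ a → ∀ {c} → c ≡ a → to c ≡ b
      to-sur (z , q) = let x , p , eq = sur z q in (x , p) , λ { refl → ∈-≡ eq }

    toTable : ∀ {D D′} → PerfectMatching D D′ → ∃ (Table D D′)
    toTable {D} {D′} (f , adj) = tabulate g , val , inj , sur
      where
      open Bijection f using (to; injective; strictlySurjective)
      g : Fin n → Fin n
      g x with x ∈? D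
      ... | yes p = proj₁ (to (x , p))
      ... | no  _ = x
      g≡ : ∀ x (p : x ∈ D) → g x ≡ proj₁ (to (x , p))
      g≡ x p with x ∈? D
      ... | yes q = cong (λ r → proj₁ (to (x , r))) ([]=-irrelevant q p)
      ... | no ¬p = contradiction p ¬p
      eq : ∀ x (p : x ∈ D) → lookup (tabulate g) x ≡ proj₁ (to (x , p))
      eq x p = trans (lookup∘tabulate g x) (g≡ x p)
      val : ∀ x → x ∈ D → lookup (tabulate g) x ∈ D′ × Adj x (lookup (tabulate g) x)
      val x p = subst (_∈ D′) (sym (eq x p)) (proj₂ (to (x , p)))
              , subst (Adj x) (sym (eq x p)) (adj (x , p))
      inj : ∀ x y → x ∈ D → y ∈ D → lookup (tabulate g) x ≡ lookup (tabulate g) y → x ≡ y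
      inj x y p q e =
        cong proj₁ (injective (∈-≡ (trans (sym (eq x p)) (trans e (eq y q)))))
      sur : ∀ z → z ∈ D′ → ∃ λ x → x ∈ D × lookup (tabulate g) x ≡ z
      sur z q = let (x , p) , e = strictlySurjective (z , q)
                in x , p , trans (eq x p) (cong proj₁ e)

  perfectMatching? : B.Decidable PerfectMatching
  perfectMatching? D D′ = map′ fromTable toTable (anyVec? n (table? D D′))

  swapSet? : Decidable SwapSet
  swapSet? D = dominating? D ×-dec anySubset? λ D′ →
    dominating? D′ ×-dec ¬? (nonempty? (D ∩ D′)) ×-dec
    (∣ D ∣ ≟ ∣ D′ ∣) ×-dec perfectMatching? D D′

  independenceNumber : ∃ (Maximum Independent)
  independenceNumber = maximum independent? (⊥ , λ _ _ x∈⊥ → contradiction x∈⊥ ∉⊥)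

  swapNumber : ∃ (Minimum SwapSet)
  swapNumber = minimum swapSet?

  α : ℕ
  α = proj₁ independenceNumber

  DDₘ : ℕ ⁺
  DDₘ = proj₁ swapNumber

{-# OPTIONS --safe #-}
module Submission where

-- Since α(G) = 2, every non-edge is a dominating pair. If G has two disjoint
-- non-edges, each vertex of one has a neighbour in the other, and a bipartite
-- graph on 2 + 2 vertices without isolated vertices has a perfect matching.
-- Otherwise, as the complement of G is triangle-free, its edges form a star
-- with some centre x. If xy is a non-edge, u a neighbour of x and t a fourth
-- vertex, then u is adjacent to all other vertices and {x , y}, {u , t} are
-- dominating pairs with matching xu, yt.

open import Defs
open import Data.Fin.Base using (Fin; zero; suc)
open import Data.Fin.Properties using (_≟_; any?)
open import Data.Fin.Subset using (Subset; inside; outside; _∈_; _∉_; _∪_; _∩_; ⁅_⁆; ∣_∣; Empty; ⊤; ⊥)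
open import Data.Fin.Subset.Properties
open import Data.Nat.Base using (ℕ; suc; _≤_; _<_; _>_; z<s; s<s)
open import Data.Nat.Properties using (<⇒≱; 1+n≰n; ≤-reflexive; ≤-trans)
open import Data.Product.Base using (∃; ∃₂; _×_; _,_; proj₁; proj₂)
open import Data.Sum.Base as Sum using (_⊎_; inj₁; inj₂)
open import Data.Vec.Base using (_∷_; here; there)
open import Data.Vec.Properties.WithK using ([]=-irrelevant)
open import Function.Base using (_∘_)
open import Function.Bundles using (mk↔ₛ′)
open import Function.Properties.Inverse using (↔⇒⤖)
open import Relation.Binary.Construct.Closure.ReflexiveTransitive using (ε; _◅_)
open import Relation.Binary.Construct.Add.Supremum.NonStrict _≤_ using () renaming ([_] to ≤⇒≤⁺)
import Relation.Binary.Definitions as B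
open import Relation.Binary.PropositionalEquality using (_≡_; _≢_; refl; sym; trans; cong; subst; subst₂; ≢-sym)
open import Relation.Nullary using (¬_; yes; no; contradiction)
open import Relation.Nullary.Construct.Add.Supremum using (_⁺; ⊤⁺; [_])
open import Relation.Nullary.Decidable using (¬?; _×-dec_; decidable-stable)

private
  variable
    n : ℕ
    p : Subset n
    a b c d x y : Fin n

-- Cardinalities of subsets with at most three elements.

x∉p⇒∣⁅x⁆∪p∣≡1+∣p∣ : ∀ x (p : Subset n) → x ∉ p → ∣ ⁅ x ⁆ ∪ p ∣ ≡ suc ∣ p ∣
x∉p⇒∣⁅x⁆∪p∣≡1+∣p∣ zero    (inside  ∷ p) x∉p = contradiction here x∉p
x∉p⇒∣⁅x⁆∪p∣≡1+∣p∣ zero    (outside ∷ p) x∉p = cong (suc ∘ ∣_∣) (∪-identityˡ p)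
x∉p⇒∣⁅x⁆∪p∣≡1+∣p∣ (suc x) (inside  ∷ p) x∉p = cong suc (x∉p⇒∣⁅x⁆∪p∣≡1+∣p∣ x p (x∉p ∘ there))
x∉p⇒∣⁅x⁆∪p∣≡1+∣p∣ (suc x) (outside ∷ p) x∉p = x∉p⇒∣⁅x⁆∪p∣≡1+∣p∣ x p (x∉p ∘ there)

-- Counting as a source of witnesses: it later yields two distinct members of a 2-set and a vertex
-- outside a triple.
∣p∣<∣q∣⇒∃∈q∉p : ∀ (p q : Subset n) → ∣ p ∣ < ∣ q ∣ → ∃ λ x → x ∈ q × x ∉ p
∣p∣<∣q∣⇒∃∈q∉p p q lt with any? (λ x → (x ∈? q) ×-dec ¬? (x ∈? p))
... | yes found = found
... | no  none  = contradiction (p⊆q⇒∣p∣≤∣q∣ q⊆p) (<⇒≱ lt)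
  where
  q⊆p : ∀ {x} → x ∈ q → x ∈ p
  q⊆p {x} x∈q = decidable-stable (x ∈? p) λ x∉p → none (x , x∈q , x∉p)

∈∧∉⇒≢ : x ∈ p → y ∉ p → x ≢ y
∈∧∉⇒≢ x∈p y∉p refl = y∉p x∈p

⁅_&_⁆ : Fin n → Fin n → Subset n
⁅ a & b ⁆ = ⁅ a ⁆ ∪ ⁅ b ⁆

∈-pairˡ : a ∈ ⁅ a & b ⁆
∈-pairˡ {a = a} = x∈p∪q⁺ (inj₁ (x∈⁅x⁆ a))

∈-pairʳ : b ∈ ⁅ a & b ⁆
∈-pairʳ {b = b} = x∈p∪q⁺ (inj₂ (x∈⁅x⁆ b))

∈-pair⁻ : x ∈ ⁅ a & b ⁆ → x ≡ a ⊎ x ≡ b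
∈-pair⁻ {a = a} {b = b} = Sum.map (x∈⁅y⁆⇒x≡y a) (x∈⁅y⁆⇒x≡y b) ∘ x∈p∪q⁻ ⁅ a ⁆ ⁅ b ⁆

∣pair∣≡2 : a ≢ b → ∣ ⁅ a & b ⁆ ∣ ≡ 2
∣pair∣≡2 {a = a} {b = b} a≢b =
  trans (x∉p⇒∣⁅x⁆∪p∣≡1+∣p∣ a ⁅ b ⁆ (a≢b ∘ x∈⁅y⁆⇒x≡y b)) (cong suc (∣⁅x⁆∣≡1 b))

∣triple∣≡3 : x ≢ a → x ≢ b → a ≢ b → ∣ ⁅ x ⁆ ∪ ⁅ a & b ⁆ ∣ ≡ 3
∣triple∣≡3 {x = x} {a = a} {b = b} x≢a x≢b a≢b =
  trans (x∉p⇒∣⁅x⁆∪p∣≡1+∣p∣ x ⁅ a & b ⁆ (Sum.[ x≢a , x≢b ] ∘ ∈-pair⁻)) (cong suc (∣pair∣≡2 a≢b))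

∣p∣≡2⇒distinct : ∀ (p : Subset n) → ∣ p ∣ ≡ 2 → ∃₂ λ x y → x ≢ y × x ∈ p × y ∈ p
∣p∣≡2⇒distinct {n} p ∣p∣≡2 =
  let x , x∈p , _   = ∣p∣<∣q∣⇒∃∈q∉p ⊥ p (bound (∣⊥∣≡0 n) z<s)
      y , y∈p , y∉x = ∣p∣<∣q∣⇒∃∈q∉p ⁅ x ⁆ p (bound (∣⁅x⁆∣≡1 x) (s<s z<s))
  in x , y , ∈∧∉⇒≢ (x∈⁅x⁆ x) y∉x , x∈p , y∈p
  where
  bound : ∀ {m k} → m ≡ k → k < 2 → m < ∣ p ∣
  bound m≡k = subst₂ _<_ (sym m≡k) (sym ∣p∣≡2)

-- Restricted to {a , b}, the map a ↦ c, b ↦ d; other vertices also go to d.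
send : (a c d x : Fin n) → Fin n
send a c d x with x ≟ a
... | yes _ = c
... | no  _ = d

send-∈ : ∀ a x → send a c d x ∈ ⁅ c & d ⁆
send-∈ a x with x ≟ a
... | yes _ = ∈-pairˡ
... | no  _ = ∈-pairʳ

-- The way back tests for `c`, so `d` returns to `b` only because it differs from `c`. Exchanging
-- the two pairs gives the other inverse law.
send-inverse : c ≢ d → x ∈ ⁅ a & b ⁆ → send c a b (send a c d x) ≡ x
send-inverse {c = c} {d = d} {x = x} {a = a} c≢d x∈ with x ≟ a
send-inverse {c = c} c≢d x∈ | yes x≡a with c ≟ c
... | yes _  = sym x≡a
... | no c≢c = contradiction refl c≢c
send-inverse {c = c} {d = d} c≢d x∈ | no x≢a with d ≟ c
... | yes d≡c = contradiction (sym d≡c) c≢d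
... | no  _   = sym (Sum.[ (λ x≡a → contradiction x≡a x≢a) , (λ x≡b → x≡b) ] (∈-pair⁻ x∈))

∃∈-≡ : {u v : ∃ (_∈ p)} → proj₁ u ≡ proj₁ v → u ≡ v
∃∈-≡ {u = x , x∈p} {v = _ , x∈p′} refl = cong (x ,_) ([]=-irrelevant x∈p x∈p′)

Minimum⇒≤⁺ : {P : Subset n → Set} (k : ℕ ⁺) → Minimum P k → ∀ p → P p → k ≤⁺ [ ∣ p ∣ ]
Minimum⇒≤⁺ ⊤⁺    none        p Pp = contradiction (p , Pp) none
Minimum⇒≤⁺ [ k ] (_ , least) p Pp = ≤⇒≤⁺ (least p Pp)

-- Non-edges and swap sets of size two.

module _ {n : ℕ} (G : Graph n) where

  open Graph G

  NonEdge : Fin n → Fin n → Set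
  NonEdge a b = a ≢ b × ¬ Adj a b

  nonEdge? : B.Decidable NonEdge
  nonEdge? a b = ¬? (a ≟ b) ×-dec ¬? (adj? a b)

  nonEdge-sym : NonEdge a b → NonEdge b a
  nonEdge-sym (a≢b , a≁b) = ≢-sym a≢b , a≁b ∘ adj-sym

  ¬nonEdge⇒adj : a ≢ b → ¬ NonEdge a b → Adj a b
  ¬nonEdge⇒adj {a} {b} a≢b ¬ab = decidable-stable (adj? a b) λ a≁b → ¬ab (a≢b , a≁b)

  SwapPair : Set
  SwapPair = ∃ λ D → SwapSet G D × ∣ D ∣ ≡ 2

  adj⇒≢ : Adj a b → a ≢ b
  adj⇒≢ ab refl = adj-irr ab

  pair-matching : a ≢ b → c ≢ d → Adj a c → Adj b d → PerfectMatching G ⁅ a & b ⁆ ⁅ c & d ⁆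
  pair-matching {a} {b} {c} {d} a≢b c≢d ac bd =
    ↔⇒⤖ (mk↔ₛ′
      (λ (x , _) → send a c d x , send-∈ a x)
      (λ (y , _) → send c a b y , send-∈ c y)
      (λ (_ , y∈) → ∃∈-≡ (send-inverse a≢b y∈))
      (λ (_ , x∈) → ∃∈-≡ (send-inverse c≢d x∈))) ,
    λ (x , x∈) → adj-send x x∈
    where
    adj-send : ∀ x → x ∈ ⁅ a & b ⁆ → Adj x (send a c d x)
    adj-send x x∈ with x ≟ a | ∈-pair⁻ x∈
    ... | yes refl | _         = ac
    ... | no  x≢a  | inj₁ x≡a  = contradiction x≡a x≢a
    ... | no  _    | inj₂ refl = bd

  -- Disjointness takes four inequalities; `a ≢ c` and `b ≢ d` come from the matching edges.
  pair-swap : a ≢ b → c ≢ d → a ≢ d → b ≢ c → Adj a c → Adj b d →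
              Dominating G ⁅ a & b ⁆ → Dominating G ⁅ c & d ⁆ → SwapPair
  pair-swap {a} {b} {c} {d} a≢b c≢d a≢d b≢c ac bd dom dom′ =
    ⁅ a & b ⁆ ,
    (dom , ⁅ c & d ⁆ , dom′ , disjoint ,
      trans (∣pair∣≡2 a≢b) (sym (∣pair∣≡2 c≢d)) , pair-matching a≢b c≢d ac bd) ,
    ∣pair∣≡2 a≢b
    where
    disjoint : Empty (⁅ a & b ⁆ ∩ ⁅ c & d ⁆)
    disjoint (x , x∈) with x∈p∩q⁻ ⁅ a & b ⁆ ⁅ c & d ⁆ x∈
    ... | x∈ab , x∈cd with ∈-pair⁻ x∈ab | ∈-pair⁻ x∈cd
    ... | inj₁ refl | inj₁ x≡c = adj⇒≢ ac x≡c
    ... | inj₁ refl | inj₂ x≡d = a≢d x≡d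
    ... | inj₂ refl | inj₁ x≡c = b≢c x≡c
    ... | inj₂ refl | inj₂ x≡d = adj⇒≢ bd x≡d

  -- The two consequences of α(G) = 2.

  α≡2⇒nonEdge : α G ≡ 2 → ∃₂ NonEdge
  α≡2⇒nonEdge α≡2 =
    let (S , ind , ∣S∣≡α) , _ = proj₂ (independenceNumber G)
        x , y , x≢y , x∈S , y∈S = ∣p∣≡2⇒distinct S (trans ∣S∣≡α α≡2)
    in x , y , x≢y , ind x y x∈S y∈S

  -- Triangle-freeness of the complement, the form in which the bound α(G) ≤ 2 is used.
  NoIndependentTriple : Set
  NoIndependentTriple = ∀ {x y z} → NonEdge x y → NonEdge x z → ¬ NonEdge y z

  α≡2⇒noIndependentTriple : α G ≡ 2 → NoIndependentTriple
  α≡2⇒noIndependentTriple α≡2 {x} {y} {z} (x≢y , x≁y) (x≢z , x≁z) (y≢z , y≁z) =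
    1+n≰n (≤-trans (≤-reflexive (sym (∣triple∣≡3 x≢y x≢z y≢z)))
          (≤-trans (proj₂ (proj₂ (independenceNumber G)) T independent) (≤-reflexive α≡2)))
    where
    T : Subset n
    T = ⁅ x ⁆ ∪ ⁅ y & z ⁆
    ∈T⁻ : ∀ {v} → v ∈ T → v ≡ x ⊎ (v ≡ y ⊎ v ≡ z)
    ∈T⁻ = Sum.map (x∈⁅y⁆⇒x≡y x) ∈-pair⁻ ∘ x∈p∪q⁻ ⁅ x ⁆ ⁅ y & z ⁆
    independent : Independent G T
    independent u v u∈ v∈ with ∈T⁻ u∈ | ∈T⁻ v∈
    ... | inj₁ refl        | inj₁ refl        = adj-irr
    ... | inj₁ refl        | inj₂ (inj₁ refl) = x≁y
    ... | inj₁ refl        | inj₂ (inj₂ refl) = x≁z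
    ... | inj₂ (inj₁ refl) | inj₁ refl        = x≁y ∘ adj-sym
    ... | inj₂ (inj₁ refl) | inj₂ (inj₁ refl) = adj-irr
    ... | inj₂ (inj₁ refl) | inj₂ (inj₂ refl) = y≁z
    ... | inj₂ (inj₂ refl) | inj₁ refl        = x≁z ∘ adj-sym
    ... | inj₂ (inj₂ refl) | inj₂ (inj₁ refl) = y≁z ∘ adj-sym
    ... | inj₂ (inj₂ refl) | inj₂ (inj₂ refl) = adj-irr

  -- Swap pairs when the complement is triangle-free.

  module _ (no-triple : NoIndependentTriple) where

    adj-nonEdge : NonEdge a b → x ≢ a → x ≢ b → Adj x a ⊎ Adj x b
    adj-nonEdge {a} {b} {x} ab x≢a x≢b with adj? x a
    ... | yes xa = inj₁ xa
    ... | no x≁a = inj₂ (¬nonEdge⇒adj x≢b λ xb → no-triple (x≢a , x≁a) xb ab)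

    nonEdge-dominating : NonEdge a b → Dominating G ⁅ a & b ⁆
    nonEdge-dominating ab x x∉ =
      Sum.[ (λ xa → _ , ∈-pairˡ , xa) , (λ xb → _ , ∈-pairʳ , xb) ]
        (adj-nonEdge ab (≢-sym (∈∧∉⇒≢ ∈-pairˡ x∉)) (≢-sym (∈∧∉⇒≢ ∈-pairʳ x∉)))

    nonEdges-matched : NonEdge a b → NonEdge c d → a ≢ c → a ≢ d → b ≢ c → b ≢ d →
                       (Adj a c × Adj b d) ⊎ (Adj a d × Adj b c)
    nonEdges-matched {a} {b} {c} {d} ab cd a≢c a≢d b≢c b≢d with adj? a c | adj? b d
    ... | yes ac | yes bd = inj₁ (ac , bd)
    -- The neighbour of `a` among `c`, `d` must be `d`, and that of `c` among `a`, `b` must be `b`.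
    ... | no a≁c | _      = inj₂
      ( Sum.fromInj₂ (λ ac → contradiction ac a≁c) (adj-nonEdge cd a≢c a≢d)
      , adj-sym (Sum.fromInj₂ (λ ca → contradiction (adj-sym ca) a≁c)
                              (adj-nonEdge ab (≢-sym a≢c) (≢-sym b≢c))))
    -- The same argument at `d` and `b`.
    ... | yes _  | no b≁d = inj₂
      ( adj-sym (Sum.fromInj₁ (λ db → contradiction (adj-sym db) b≁d)
                              (adj-nonEdge ab (≢-sym a≢d) (≢-sym b≢d)))
      , Sum.fromInj₁ (λ bd → contradiction bd b≁d) (adj-nonEdge cd b≢c b≢d))

    disjoint-nonEdges-swap : NonEdge a b → NonEdge c d →
                             a ≢ c → a ≢ d → b ≢ c → b ≢ d → SwapPair
    disjoint-nonEdges-swap ab cd a≢c a≢d b≢c b≢d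
      with nonEdges-matched ab cd a≢c a≢d b≢c b≢d
    ... | inj₁ (ac , bd) = pair-swap (proj₁ ab) (proj₁ cd) a≢d b≢c ac bd
                             (nonEdge-dominating ab) (nonEdge-dominating cd)
    ... | inj₂ (ad , bc) = pair-swap (proj₁ ab) (≢-sym (proj₁ cd)) a≢c b≢d ad bc
                             (nonEdge-dominating ab) (nonEdge-dominating (nonEdge-sym cd))

    star-swap : Connected G → n > 3 → NonEdge x y →
                (∀ {s t} → s ≢ x → t ≢ x → s ≢ t → Adj s t) → SwapPair
    star-swap {x} {y} connected n>3 xy@(x≢y , x≁y) clique with connected x y
    ... | ε = contradiction refl x≢y
    -- The first edge of a path from `x` to `y` supplies the neighbour `u`.
    ... | _◅_ {j = u} xu _ =
      let u≢y           = λ { refl → x≁y xu }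
          u≢x           = ≢-sym (adj⇒≢ xu)
          -- With at least four vertices, some `t` lies outside {u , x , y}.
          t , _ , t∉xyu = ∣p∣<∣q∣⇒∃∈q∉p (⁅ u ⁆ ∪ ⁅ x & y ⁆) ⊤
                            (subst₂ _<_ (sym (∣triple∣≡3 u≢x u≢y x≢y)) (sym (∣⊤∣≡n n)) n>3)
          u≢t           = ∈∧∉⇒≢ (x∈p∪q⁺ (inj₁ (x∈⁅x⁆ u))) t∉xyu
          x≢t           = ∈∧∉⇒≢ (x∈p∪q⁺ (inj₂ ∈-pairˡ)) t∉xyu
          y≢t           = ∈∧∉⇒≢ (x∈p∪q⁺ (inj₂ ∈-pairʳ)) t∉xyu
      in pair-swap x≢y u≢t x≢t (≢-sym u≢y) xu
           (clique (≢-sym x≢y) (≢-sym x≢t) y≢t) (nonEdge-dominating xy) (dominating u≢x)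
      where
      -- Already `u` dominates: it is adjacent to `x` by choice and to the rest by `clique`.
      dominating : ∀ {t} → u ≢ x → Dominating G ⁅ u & t ⁆
      dominating u≢x z z∉ with z ≟ x
      ... | yes refl = u , ∈-pairˡ , xu
      ... | no  z≢x  = u , ∈-pairˡ , clique z≢x u≢x (≢-sym (∈∧∉⇒≢ ∈-pairˡ z∉))

    -- A non-edge avoiding `x` either avoids `y` too, against `outer`, or joins `y` to a vertex
    -- other than `x`, against `inner`. So all non-edges pass through `x`.
    star-clique : (∀ {s t} → NonEdge s t → s ≢ x → t ≢ x → s ≢ y → ¬ t ≢ y) →
                  (∀ {t} → NonEdge y t → ¬ t ≢ x) →
                  ∀ {s t} → s ≢ x → t ≢ x → s ≢ t → Adj s t
    star-clique {x} {y} outer inner {s} {t} s≢x t≢x s≢t = ¬nonEdge⇒adj s≢t λ st →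
      outer st s≢x t≢x (λ { refl → inner st t≢x }) (λ { refl → inner (nonEdge-sym st) s≢x })

    swapPair : Connected G → n > 3 → ∃₂ NonEdge → SwapPair
    swapPair connected n>3 (x , y , xy@(x≢y , _))
      with any? (λ s → any? λ t → nonEdge? s t ×-dec
                  ¬? (s ≟ x) ×-dec ¬? (t ≟ x) ×-dec ¬? (s ≟ y) ×-dec ¬? (t ≟ y))
    ... | yes (s , t , st , s≢x , t≢x , s≢y , t≢y) =
      disjoint-nonEdges-swap xy st (≢-sym s≢x) (≢-sym t≢x) (≢-sym s≢y) (≢-sym t≢y)
    ... | no none
      with any? (λ s → nonEdge? x s ×-dec ¬? (s ≟ y)) | any? (λ t → nonEdge? y t ×-dec ¬? (t ≟ x))
    -- Both ends of `xy` lie on a further non-edge. These two are disjoint, as `s ≡ t` would make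
    -- `x`, `y`, `s` independent.
    ... | yes (s , xs , s≢y) | yes (t , yt , t≢x) =
      disjoint-nonEdges-swap xs yt x≢y (≢-sym t≢x) s≢y
        λ { refl → no-triple xy xs yt }
    -- Here `xy` is the only non-edge at `x`, so the star has centre `y`.
    ... | no noneˣ | _ = star-swap connected n>3 (nonEdge-sym xy) (star-clique
      (λ st s≢y t≢y s≢x t≢x → none (_ , _ , st , s≢x , t≢x , s≢y , t≢y))
      (λ xt t≢y → noneˣ (_ , xt , t≢y)))
    -- Here `xy` is the only non-edge at `y`, so the centre is `x`.
    ... | yes _ | no noneʸ = star-swap connected n>3 xy (star-clique
      (λ st s≢x t≢x s≢y t≢y → none (_ , _ , st , s≢x , t≢x , s≢y , t≢y))
      (λ yt t≢x → noneʸ (_ , yt , t≢x)))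

theorem32 : (n : ℕ) (G : Graph n) → Connected G → n > 3 → α G ≡ 2 →
    (∃ λ D → SwapSet G D) × (DDₘ G ≤⁺ [ 2 ])
theorem32 n G connected n>3 α≡2 =
  let D , swap , ∣D∣≡2 = swapPair G (α≡2⇒noIndependentTriple G α≡2) connected n>3 (α≡2⇒nonEdge G α≡2)
  in (D , swap) ,
     subst (λ k → DDₘ G ≤⁺ [ k ]) ∣D∣≡2 (Minimum⇒≤⁺ (DDₘ G) (proj₂ (swapNumber G)) D swap)
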